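{- Let $n\ge2$, let $y\in\mathbb{R}$, and let $C:\mathbb{Q}\to\{<,=,>\}$ satisfy $C(t)=\operatorname{cmp}(y,t)$ for every rational $t$, where $\operatorname{cmp}(y,t)$ is the ordering of $y$ relative to $t$. Then the signed comparator-based search run with $C$ returns $\Pi_n(y)$, the standard $n$-bit posit rounding of $y$. In particular, the rational executable rounder (the same search run with $C(t)=\operatorname{cmp}(q,t)$ for a rational $q$) returns $\Pi_n(q)$ for every rational input $q$.
   Context: Posits (2022 standard, two exponent bits). Posit words of width $n$ are elements of $W_n=\{0,\dots,2^n-1\}$ ($n$-bit vectors), with negation of a word meaning two's-complement negation modulo $2^n$; the word $2^{n-1}$ is the exceptional value NaR. For a nonnegative code $u\in\{0,\dots,2^{n-1}-1\}$, the value $D_n(u)\in\mathbb{Q}$ is: $D_n(0)=0$; for $u>0$ write $u$ as $n-1$ bits, let $k\ge1$ be the length of the maximal run of equal leading bits, and let the regime be $\rho=-k$ if these bits are $0$ and $\rho=k-1$ if they are $1$; skip the run and the terminating opposite bit (if present); the next two bits (missing bits being read as $0$) give the exponent $e\in\{0,1,2,3\}$, most significant first, and the remaining $m\ge 0$ bits, read as an integer $f$, give the fraction $f/2^m$; then $D_n(u)=2^{4\rho+e}(1+f/2^m)$. $D_n$ is strictly increasing, with least positive value $\mathrm{minpos}=D_n(1)$ and greatest value $\mathrm{maxpos}=D_n(2^{n-1}-1)$. Rounding thresholds. For adjacent codes $u,u+1$ the threshold is $T_n(u)=D_{n+1}(2u+1)$ (append a bit one to the code in the format one bit wider). Specification $\Pi_n:\mathbb{R}\to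 W_n$. $\Pi_n(0)=0$. For $y>0$: if $y\le\mathrm{minpos}$ the result is code $1$; if $y\ge\mathrm{maxpos}$ the result is code $2^{n-1}-1$; otherwise let $c$ be the greatest code with $D_n(c)\le y$, and the result is $c$ if $y<T_n(c)$, $c+1$ if $y>T_n(c)$, and whichever of $c,c+1$ is even if $y=T_n(c)$. For $y<0$, $\Pi_n(y)$ is the negation of the word $\Pi_n(-y)$. Signed comparator-based search with comparator $C$. If $C(0)$ is $=$, return $0$. If $C(0)$ is $>$, return the magnitude search with $C$. If $C(0)$ is $<$, return the word negation of the magnitude search with the comparator $t\mapsto$ the reverse (swapping $<$ and $>$) of $C(-t)$. The magnitude search with a comparator $C$: if $C(\mathrm{minpos})\in\{<,=\}$ return code $1$; if $C(\mathrm{maxpos})\in\{>,=\}$ return code $2^{n-1}-1$; otherwise bisect for the lower code, starting from $\ell=0$, $h=2^{n-1}$, for $n$ steps, where each step (while $h-\ell>1$) takes the midpoint $m=\lfloor(\ell+h)/2\rfloor$ and sets $h:=m$ if $C(D_n(m))$ is $<$ and $\ell:=m$ otherwise; with the resulting $\ell$, return $\ell$ if $C(T_n(\ell))$ is $<$, $\ell+1$ if it is $>$, and the even one of $\ell,\ell+1$ if it is $=$. -}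

module Defs where

open import Data.Bool.Base using (Bool; true; false; if_then_else_)
open import Data.Bool.Properties using () renaming (_≟_ to _≟ᵇ_)
open import Data.Fin.Base using (Fin; toℕ)
open import Data.Integer.Base using (ℤ; +_; -[1+_])
import Data.Integer.Base as ℤ
open import Data.List.Base using (List; []; _∷_; length; drop; takeWhile; dropWhile)
open import Data.Nat.Base
  using (ℕ; zero; suc; _+_; _*_; _∸_; _^_; _/_; _%_; _≤_; _<_; _≡ᵇ_; _<ᵇ_)
open import Data.Nat.Divisibility using (_∣_)
open import Data.Nat.DivMod using (_mod_)
open import Data.Nat.Properties using (m^n≢0)
open import Data.Product.Base using (_×_; _,_; ∃; ∃-syntax)
open import Data.Rational.Base using (ℚ; 0ℚ; 1ℚ)
import Data.Rational.Base as ℚ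
import Data.Rational.Properties as ℚₚ
open import Data.Sum.Base using (_⊎_; inj₁; inj₂; swap)
open import Relation.Binary.Definitions using (tri<; tri≈; tri>)
open import Relation.Binary.PropositionalEquality using (_≡_; refl; sym; subst)
open import Relation.Nullary.Negation using (¬_)
open import Algebra.Properties.Group ℚₚ.+-0-group using () renaming (⁻¹-involutive to neg-involutive)

-- A real y as a two-sided Dedekind cut: L q means q < y, U q means y < q.
record ℝ : Set₁ where
  field
    L U         : ℚ → Set
    L-inhabited : ∃ L
    U-inhabited : ∃ U
    L-lower     : ∀ {p q} → p ℚ.< q → L q → L p
    U-upper     : ∀ {p q} → p ℚ.< q → U p → U q
    L-open      : ∀ {p} → L p → ∃[ q ] (p ℚ.< q × L q)
    U-open      : ∀ {q} → U q → ∃[ p ] (p ℚ.< q × U p)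
    disjoint    : ∀ {q} → ¬ (L q × U q)
    located     : ∀ {p q} → p ℚ.< q → L p ⊎ U q

infix 4 _<ᵣ_ _≤ᵣ_ _≈ᵣ_

_<ᵣ_ : ℝ → ℝ → Set
x <ᵣ y = ∃[ q ] (ℝ.U x q × ℝ.L y q)

_≤ᵣ_ : ℝ → ℝ → Set
x ≤ᵣ y = ¬ (y <ᵣ x)

_≈ᵣ_ : ℝ → ℝ → Set
x ≈ᵣ y = x ≤ᵣ y × y ≤ᵣ x

private
  ℚ-located : ∀ r {p q} → p ℚ.< q → p ℚ.< r ⊎ r ℚ.< q
  ℚ-located r {p} p<q with ℚₚ.<-cmp p r
  ... | tri< p<r _ _   = inj₁ p<r
  ... | tri≈ _ refl _  = inj₂ p<q
  ... | tri> _ _ r<p   = inj₂ (ℚₚ.<-trans r<p p<q)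

  ℚ-below : ∀ r → ∃[ q ] q ℚ.< r
  ℚ-below r = r ℚ.- 1ℚ ,
    subst (r ℚ.- 1ℚ ℚ.<_) (ℚₚ.+-identityʳ r)
      (ℚₚ.+-monoʳ-< r (ℚₚ.negative⁻¹ (ℚ.- 1ℚ)))

  ℚ-above : ∀ r → ∃[ q ] r ℚ.< q
  ℚ-above r = r ℚ.+ 1ℚ ,
    subst (ℚ._< r ℚ.+ 1ℚ) (ℚₚ.+-identityʳ r)
      (ℚₚ.+-monoʳ-< r (ℚₚ.positive⁻¹ 1ℚ))

fromℚ : ℚ → ℝ
fromℚ r = record
  { L           = ℚ._< r
  ; U           = r ℚ.<_
  ; L-inhabited = ℚ-below r
  ; U-inhabited = ℚ-above r
  ; L-lower     = ℚₚ.<-trans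
  ; U-upper     = λ p<q r<p → ℚₚ.<-trans r<p p<q
  ; L-open      = λ p<r → let (q , p<q , q<r) = ℚₚ.<-dense p<r in q , p<q , q<r
  ; U-open      = λ r<q → let (p , r<p , p<q) = ℚₚ.<-dense r<q in p , p<q , r<p
  ; disjoint    = λ (q<r , r<q) → ℚₚ.<-asym q<r r<q
  ; located     = ℚ-located r
  }

-ᵣ_ : ℝ → ℝ
-ᵣ y = record
  { L           = λ q → U (ℚ.- q)
  ; U           = λ q → L (ℚ.- q)
  ; L-inhabited = let (q , u) = U-inhabited in ℚ.- q , subst U (sym (neg-involutive q)) u
  ; U-inhabited = let (q , l) = L-inhabited in ℚ.- q , subst L (sym (neg-involutive q)) l
  ; L-lower     = λ p<q → U-upper (ℚₚ.neg-antimono-< p<q)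
  ; U-upper     = λ p<q → L-lower (ℚₚ.neg-antimono-< p<q)
  ; L-open      = λ {p} u → let (q , q<-p , uq) = U-open u in
      ℚ.- q
    , subst (ℚ._< ℚ.- q) (neg-involutive p) (ℚₚ.neg-antimono-< q<-p)
    , subst U (sym (neg-involutive q)) uq
  ; U-open      = λ {q} l → let (p , -q<p , lp) = L-open l in
      ℚ.- p
    , subst (ℚ.- p ℚ.<_) (neg-involutive q) (ℚₚ.neg-antimono-< -q<p)
    , subst L (sym (neg-involutive p)) lp
  ; disjoint    = λ (u , l) → disjoint (l , u)
  ; located     = λ p<q → swap (located (ℚₚ.neg-antimono-< p<q))
  }
  where open ℝ y

data Cmp : Set where
  less equal greater : Cmp

reverse : Cmp → Cmp
reverse less    = greater
reverse equal   = equal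
reverse greater = less

-- The graph of cmp(y , t): on ℝ the ordering is not computable, so cmp is
-- given as a relation between y, t and the result.
cmp[_,_]≡_ : ℝ → ℚ → Cmp → Set
cmp[ y , t ]≡ less    = y <ᵣ fromℚ t
cmp[ y , t ]≡ equal   = y ≈ᵣ fromℚ t
cmp[ y , t ]≡ greater = fromℚ t <ᵣ y

cmpℚ : ℚ → ℚ → Cmp
cmpℚ q t with ℚₚ.<-cmp q t
... | tri< _ _ _ = less
... | tri≈ _ _ _ = equal
... | tri> _ _ _ = greater

Word : ℕ → Set
Word n = Fin (2 ^ n)

word : ∀ n → ℕ → Word n
word n u = _mod_ u (2 ^ n) {{m^n≢0 2 n}}

negWord : ∀ n → Word n → Word n
negWord n w = word n (2 ^ n ∸ toℕ w)

-- The k low-order bits of u, most significant first.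
bits : ℕ → ℕ → List Bool
bits zero    u = []
bits (suc k) u = (_/_ u (2 ^ k) {{m^n≢0 2 k}} % 2 ≡ᵇ 1) ∷ bits k u

bitℕ : Bool → ℕ
bitℕ false = 0
bitℕ true  = 1

bitsℕ : List Bool → ℕ
bitsℕ []       = 0
bitsℕ (b ∷ bs) = bitℕ b * 2 ^ length bs + bitsℕ bs

regime : Bool → ℕ → ℤ
regime false k = ℤ.- (+ k)
regime true  k = + k ℤ.- + 1

exponent : List Bool → ℕ
exponent []          = 0
exponent (b ∷ [])    = 2 * bitℕ b
exponent (b ∷ c ∷ _) = 2 * bitℕ b + bitℕ c

infix 7 _/2^_

_/2^_ : ℤ → ℕ → ℚ
z /2^ k = ℚ._/_ z (2 ^ k) {{m^n≢0 2 k}}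

2^ℤ_ : ℤ → ℚ
2^ℤ (+ k)    = + (2 ^ k) ℚ./ 1
2^ℤ -[1+ k ] = + 1 /2^ suc k

decode : List Bool → ℚ
decode []       = 0ℚ   -- never reached for n ≥ 2
decode (b ∷ bs) = 2^ℤ (+ 4 ℤ.* ρ ℤ.+ + e) ℚ.* (1ℚ ℚ.+ + f /2^ m)
  where
  k = length (takeWhile (b ≟ᵇ_) (b ∷ bs))
  ρ = regime b k
  -- what follows the run and its terminating bit, if any
  rest = drop 1 (dropWhile (b ≟ᵇ_) (b ∷ bs))
  e = exponent rest
  fraction = drop 2 rest
  m = length fraction
  f = bitsℕ fraction

-- Meaningful for codes u < 2 ^ (n ∸ 1).
D : ℕ → ℕ → ℚ
D n zero      = 0ℚ
D n u@(suc _) = decode (bits (n ∸ 1) u)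

maxCode : ℕ → ℕ
maxCode n = 2 ^ (n ∸ 1) ∸ 1

minpos maxpos : ℕ → ℚ
minpos n = D n 1
maxpos n = D n (maxCode n)

T : ℕ → ℕ → ℚ
T n u = D (suc n) (2 * u + 1)

record GreatestCodeBelow (n : ℕ) (y : ℝ) (c : ℕ) : Set where
  field
    isCode   : c < 2 ^ (n ∸ 1)
    below    : fromℚ (D n c) ≤ᵣ y
    greatest : ∀ c′ → c′ < 2 ^ (n ∸ 1) → fromℚ (D n c′) ≤ᵣ y → c′ ≤ c

data RoundsFrom (n : ℕ) (y : ℝ) (c : ℕ) : ℕ → Set where
  down    : y <ᵣ fromℚ (T n c) → RoundsFrom n y c c
  up      : fromℚ (T n c) <ᵣ y → RoundsFrom n y c (suc c)
  tieDown : y ≈ᵣ fromℚ (T n c) → 2 ∣ c     → RoundsFrom n y c c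
  tieUp   : y ≈ᵣ fromℚ (T n c) → 2 ∣ suc c → RoundsFrom n y c (suc c)

data Π⁺ (n : ℕ) (y : ℝ) : ℕ → Set where
  small  : y ≤ᵣ fromℚ (minpos n) → Π⁺ n y 1
  large  : fromℚ (minpos n) <ᵣ y → fromℚ (maxpos n) ≤ᵣ y → Π⁺ n y (maxCode n)
  middle : ∀ {c u} → fromℚ (minpos n) <ᵣ y → y <ᵣ fromℚ (maxpos n) →
           GreatestCodeBelow n y c → RoundsFrom n y c u → Π⁺ n y u

-- Case distinctions on a real are not decidable, so the rounding function is
-- given by its graph: Π n y w says that y rounds to the word w.
data Π (n : ℕ) (y : ℝ) (w : Word n) : Set where
  isZero : y ≈ᵣ fromℚ 0ℚ → toℕ w ≡ 0 → Π n y w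
  isPos  : fromℚ 0ℚ <ᵣ y → Π⁺ n y (toℕ w) → Π n y w
  isNeg  : y <ᵣ fromℚ 0ℚ → (v : Word n) → Π⁺ n (-ᵣ y) (toℕ v) → w ≡ negWord n v → Π n y w

bisect : ℕ → (ℚ → Cmp) → (steps ℓ h : ℕ) → ℕ
bisect n C zero    ℓ h = ℓ
bisect n C (suc s) ℓ h =
  if 1 <ᵇ h ∸ ℓ then step (C (D n m)) else bisect n C s ℓ h
  where
  m = (ℓ + h) / 2
  step : Cmp → ℕ
  step less    = bisect n C s ℓ m
  step equal   = bisect n C s m h
  step greater = bisect n C s m h

roundAt : ℕ → Cmp → ℕ
roundAt ℓ less    = ℓ
roundAt ℓ greater = suc ℓ
roundAt ℓ equal   = if ℓ % 2 ≡ᵇ 0 then ℓ else suc ℓ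

middleSearch : ℕ → (ℚ → Cmp) → ℕ
middleSearch n C = roundAt ℓ (C (T n ℓ))
  where ℓ = bisect n C n 0 (2 ^ (n ∸ 1))

-- Codes are returned as naturals; search turns them into words.
magnitudeSearch : ℕ → (ℚ → Cmp) → ℕ
magnitudeSearch n C with C (minpos n) | C (maxpos n)
... | less    | _       = 1
... | equal   | _       = 1
... | greater | greater = maxCode n
... | greater | equal   = maxCode n
... | greater | less    = middleSearch n C

search : ∀ n → (ℚ → Cmp) → Word n
search n C with C 0ℚ
... | equal   = word n 0
... | greater = word n (magnitudeSearch n C)
... | less    = negWord n (word n (magnitudeSearch n (λ t → reverse (C (ℚ.- t)))))

rationalRound : ∀ n → ℚ → Word n
rationalRound n q = search n (cmpℚ q)

{-# OPTIONS --safe #-}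
module Submission where

-- The search consults y only through comparisons, so once bisection has found
-- the greatest code with D n c ≤ y, the threshold comparison decides the
-- rounding exactly as the specification does; nothing about the position of
-- T n c is needed. Bisection is correct because D n is weakly increasing: the
-- lexicographic order on bit strings induces that on (regime, exponent,
-- fraction), and a change of 4 ρ + e by one outweighs any fraction, since
-- 2 ^ E ≤ 2 ^ E (1 + f / 2 ^ m) ≤ 2 ^ (E + 1).

open import Defs
open import Data.Bool.Base as Bool using (Bool; true; false)
open import Data.Bool.Properties using () renaming (_≟_ to _≟ᵇ_)
open import Data.Fin.Base using (toℕ)
open import Data.Fin.Properties using (toℕ-injective; toℕ-fromℕ<)
open import Data.Integer.Base as ℤ using (ℤ; +_; -[1+_])
import Data.Integer.Properties as ℤₚ
open import Data.List.Base using (List; []; _∷_; length; drop; takeWhile; dropWhile)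
open import Data.Nat.Base
open import Data.Nat.DivMod
open import Data.Nat.Divisibility using (_∣_; ∣m+n∣m⇒∣n; ∣1⇒≡1; m%n≡0⇒n∣m; n∣m*n)
open import Data.Nat.Properties
open import Data.Nat.Tactic.RingSolver using (solve)
open import Data.Product.Base as Product using (_×_; _,_)
open import Data.Rational.Base as ℚ using (ℚ; 0ℚ; 1ℚ)
import Data.Rational.Properties as ℚₚ
import Data.Rational.Unnormalised.Base as ℚᵘ
import Data.Rational.Unnormalised.Properties as ℚᵘₚ
open import Data.Sum.Base as Sum using (_⊎_; inj₁; inj₂)
open import Function.Base using (_∘_)
open import Function.Bundles using (_⇔_; mk⇔)
open import Relation.Binary.Definitions using (tri<; tri≈; tri>)
open import Relation.Binary.PropositionalEquality
open import Relation.Nullary.Negation using (¬_; contradiction)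
open import Algebra.Properties.Group ℚₚ.+-0-group using () renaming (⁻¹-involutive to neg-involutive)

-- Dyadic rationals

-- `ℚ._/_` reduces to lowest terms, so the comparison is moved to unnormalised fractions, whose
-- order is cross-multiplication by definition.
/-mono-≤-cross : ∀ {i j d e} .{{_ : NonZero d}} .{{_ : NonZero e}} →
                 i ℤ.* + e ℤ.≤ j ℤ.* + d → i ℚ./ d ℚ.≤ j ℚ./ e
/-mono-≤-cross {i} {j} {suc d} {suc e} le = ℚₚ.toℚᵘ-cancel-≤ (begin
  ℚ.toℚᵘ (i ℚ./ suc d) ≃⟨ ℚₚ.toℚᵘ-fromℚᵘ (ℚᵘ.mkℚᵘ i d) ⟩
  ℚᵘ.mkℚᵘ i d          ≤⟨ ℚᵘ.*≤* le ⟩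
  ℚᵘ.mkℚᵘ j e          ≃⟨ ℚₚ.toℚᵘ-fromℚᵘ (ℚᵘ.mkℚᵘ j e) ⟨
  ℚ.toℚᵘ (j ℚ./ suc e) ∎)
  where open ℚᵘₚ.≤-Reasoning

+/-mono-≤-cross : ∀ {a b d e} .{{_ : NonZero d}} .{{_ : NonZero e}} →
                  a * e ≤ b * d → + a ℚ./ d ℚ.≤ + b ℚ./ e
+/-mono-≤-cross {a} {b} {d} {e} le =
  /-mono-≤-cross {+ a} {+ b} (subst₂ ℤ._≤_ (ℤₚ.pos-* a e) (ℤₚ.pos-* b d) (ℤ.+≤+ le))

-- The factor two is written `1ℚ ℚ.+ 1ℚ` to match the upper bound of `1ℚ ℚ.+ + f /2^ m` when the
-- fraction is replaced by one.
2*+/ : ∀ a b d e .{{_ : NonZero d}} .{{_ : NonZero e}} → a * 2 * e ≡ b * d →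
       + a ℚ./ d ℚ.* (1ℚ ℚ.+ 1ℚ) ≡ + b ℚ./ e
2*+/ a b (suc d) (suc e) eq = ℚₚ.toℚᵘ-injective (begin
  ℚ.toℚᵘ (+ a ℚ./ suc d ℚ.* (1ℚ ℚ.+ 1ℚ))
    ≈⟨ ℚₚ.toℚᵘ-homo-* (+ a ℚ./ suc d) (1ℚ ℚ.+ 1ℚ) ⟩
  ℚ.toℚᵘ (+ a ℚ./ suc d) ℚᵘ.* ℚᵘ.mkℚᵘ (+ 2) 0
    ≈⟨ ℚᵘₚ.*-congʳ {ℚᵘ.mkℚᵘ (+ 2) 0} (ℚₚ.toℚᵘ-fromℚᵘ (ℚᵘ.mkℚᵘ (+ a) d)) ⟩
  ℚᵘ.mkℚᵘ (+ a) d ℚᵘ.* ℚᵘ.mkℚᵘ (+ 2) 0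
    ≈⟨ ℚᵘ.*≡* cross ⟩
  ℚᵘ.mkℚᵘ (+ b) e
    ≈⟨ ℚₚ.toℚᵘ-fromℚᵘ (ℚᵘ.mkℚᵘ (+ b) e) ⟨
  ℚ.toℚᵘ (+ b ℚ./ suc e) ∎)
  where
  open ℚᵘₚ.≃-Reasoning
  cross : + a ℤ.* + 2 ℤ.* + suc e ≡ + b ℤ.* + (suc d * 1)
  cross = trans (cong (ℤ._* + suc e) (sym (ℤₚ.pos-* a 2)))
    (trans (sym (ℤₚ.pos-* (a * 2) (suc e)))
    (trans (cong +_ (trans eq (cong (b *_) (sym (*-identityʳ (suc d))))))
           (ℤₚ.pos-* b (suc d * 1))))

2^ℤ-suc : ∀ i → 2^ℤ i ℚ.* (1ℚ ℚ.+ 1ℚ) ≡ 2^ℤ (ℤ.suc i)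
2^ℤ-suc (+ k)          = 2*+/ (2 ^ k) (2 * 2 ^ k) 1 1 (cong (_* 1) (*-comm (2 ^ k) 2))
-- Here the exponent passes from negative to nonnegative; both sides are closed and compute to one.
2^ℤ-suc -[1+ zero ]    = refl
2^ℤ-suc -[1+ suc k ]   = 2*+/ 1 1 (2 ^ suc (suc k)) (2 ^ suc k) {{m^n≢0 2 (suc (suc k))}} {{m^n≢0 2 (suc k)}}
                           (sym (*-identityˡ _))

2^ℤ-mono-≤ : ∀ {i j} → i ℤ.≤ j → 2^ℤ i ℚ.≤ 2^ℤ j
2^ℤ-mono-≤ { -[1+ a ]} { -[1+ b ]} (ℤ.-≤- b≤a) =
  +/-mono-≤-cross {1} {1} {{m^n≢0 2 (suc a)}} {{m^n≢0 2 (suc b)}} (*-monoʳ-≤ 1 (^-monoʳ-≤ 2 (s≤s b≤a)))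
2^ℤ-mono-≤ { -[1+ a ]} {+ b} ℤ.-≤+ =
  +/-mono-≤-cross {1} {2 ^ b} {2 ^ suc a} {1} {{m^n≢0 2 (suc a)}} (*-mono-≤ (m^n>0 2 b) (m^n>0 2 (suc a)))
2^ℤ-mono-≤ {+ a} {+ b} (ℤ.+≤+ a≤b) =
  +/-mono-≤-cross {2 ^ a} {2 ^ b} (*-monoˡ-≤ 1 (^-monoʳ-≤ 2 a≤b))

2^ℤ-nonNeg : ∀ i → ℚ.NonNegative (2^ℤ i)
2^ℤ-nonNeg (+ k)    = ℚ.nonNegative (+/-mono-≤-cross {0} {2 ^ k} {1} {1} z≤n)
2^ℤ-nonNeg -[1+ k ] = ℚ.nonNegative (+/-mono-≤-cross {0} {1} {1} {2 ^ suc k} {{_}} {{m^n≢0 2 (suc k)}} z≤n)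

/2^-mono-≤ : ∀ {a b} k → a ≤ b → + a /2^ k ℚ.≤ + b /2^ k
/2^-mono-≤ {a} {b} k a≤b = +/-mono-≤-cross {a} {b} {{m^n≢0 2 k}} {{m^n≢0 2 k}} (*-monoˡ-≤ (2 ^ k) a≤b)

scaled : ℤ → ℕ → ℕ → ℚ
scaled E f m = 2^ℤ E ℚ.* (1ℚ ℚ.+ + f /2^ m)

scaled-mono-≤ : ∀ E m {f g} → f ≤ g → scaled E f m ℚ.≤ scaled E g m
scaled-mono-≤ E m f≤g =
  ℚₚ.*-monoˡ-≤-nonNeg (2^ℤ E) {{2^ℤ-nonNeg E}} (ℚₚ.+-monoʳ-≤ 1ℚ (/2^-mono-≤ m f≤g))

2^ℤ≤scaled : ∀ E f m → 2^ℤ E ℚ.≤ scaled E f m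
2^ℤ≤scaled E f m = subst (ℚ._≤ scaled E f m) (ℚₚ.*-identityʳ (2^ℤ E))
  (ℚₚ.*-monoˡ-≤-nonNeg (2^ℤ E) {{2^ℤ-nonNeg E}}
    (ℚₚ.+-monoʳ-≤ 1ℚ (+/-mono-≤-cross {0} {f} {1} {2 ^ m} {{_}} {{m^n≢0 2 m}} z≤n)))

scaled≤2^ℤ-suc : ∀ E f m → f ≤ 2 ^ m → scaled E f m ℚ.≤ 2^ℤ (ℤ.suc E)
scaled≤2^ℤ-suc E f m f≤ = subst (scaled E f m ℚ.≤_) (2^ℤ-suc E)
  (ℚₚ.*-monoˡ-≤-nonNeg (2^ℤ E) {{2^ℤ-nonNeg E}}
    (ℚₚ.+-monoʳ-≤ 1ℚ (+/-mono-≤-cross {f} {1} {2 ^ m} {1} {{m^n≢0 2 m}}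
      (subst₂ _≤_ (sym (*-identityʳ f)) (sym (*-identityˡ (2 ^ m))) f≤))))

-- The power `2^ℤ (ℤ.suc E)` separates the two values, so the fraction lengths `k` and `m` may
-- differ.
scaled-mono-< : ∀ {E F} f g k m → f ≤ 2 ^ k → E ℤ.< F → scaled E f k ℚ.≤ scaled F g m
scaled-mono-< {E} {F} f g k m f≤ E<F = ℚₚ.≤-trans (scaled≤2^ℤ-suc E f k f≤)
  (ℚₚ.≤-trans (2^ℤ-mono-≤ (ℤₚ.i<j⇒suc[i]≤j E<F)) (2^ℤ≤scaled F g m))

-- Bit strings of equal length in lexicographic order

-- `false<true` demands tails of equal length, so that corresponding bits keep the same place value
-- and fractions the same denominator.
data _≤ₗ_ : List Bool → List Bool → Set where
  []         : [] ≤ₗ []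
  _∷_        : ∀ b {xs ys} → xs ≤ₗ ys → (b ∷ xs) ≤ₗ (b ∷ ys)
  false<true : ∀ {xs ys} → length xs ≡ length ys → (false ∷ xs) ≤ₗ (true ∷ ys)

≤ₗ⇒length≡ : ∀ {xs ys} → xs ≤ₗ ys → length xs ≡ length ys
≤ₗ⇒length≡ []             = refl
≤ₗ⇒length≡ (b ∷ le)       = cong suc (≤ₗ⇒length≡ le)
≤ₗ⇒length≡ (false<true e) = cong suc e

bitℕ≤1 : ∀ b → bitℕ b ≤ 1
bitℕ≤1 false = z≤n
bitℕ≤1 true  = ≤-refl

bitsℕ<2^length : ∀ xs → bitsℕ xs < 2 ^ length xs
bitsℕ<2^length []           = ≤-refl
bitsℕ<2^length (b ∷ xs) = begin-strict
  bitℕ b * p + bitsℕ xs <⟨ +-mono-≤-< (*-monoˡ-≤ p (bitℕ≤1 b)) (bitsℕ<2^length xs) ⟩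
  1 * p + p             ≡⟨ +-comm (1 * p) p ⟩
  2 * p                 ∎
  where
  open ≤-Reasoning
  p = 2 ^ length xs

bitsℕ-mono : ∀ {xs ys} → xs ≤ₗ ys → bitsℕ xs ≤ bitsℕ ys
bitsℕ-mono []       = z≤n
bitsℕ-mono (b ∷ le) rewrite ≤ₗ⇒length≡ le = +-monoʳ-≤ _ (bitsℕ-mono le)
bitsℕ-mono {false ∷ xs} {true ∷ ys} (false<true e) = begin
  bitsℕ xs                        ≤⟨ <⇒≤ (bitsℕ<2^length xs) ⟩
  2 ^ length xs                   ≡⟨ cong (2 ^_) e ⟩
  2 ^ length ys                   ≡⟨ *-identityˡ _ ⟨
  1 * 2 ^ length ys               ≤⟨ m≤m+n _ _ ⟩
  1 * 2 ^ length ys + bitsℕ ys    ∎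
  where open ≤-Reasoning

infixl 7 _div2^_

_div2^_ : ℕ → ℕ → ℕ
u div2^ k = _/_ u (2 ^ k) {{m^n≢0 2 k}}

-- Quotients by 2 ^ k are compared rather than u and v bounded, because bits k u
-- ignores the digits of u above position k.
bits-mono : ∀ k {u v} → u div2^ k ≡ v div2^ k → u ≤ v → bits k u ≤ₗ bits k v
bits-mono zero    _ _ = []
bits-mono (suc k) {u} {v} eq u≤v = step (a % 2) (b % 2) refl refl (m%n<n a 2) (m%n<n b 2)
  where
  a = u div2^ k
  b = v div2^ k
  nz : NonZero (2 ^ k * 2)
  nz = m*n≢0 (2 ^ k) 2 {{m^n≢0 2 k}}
  half : ∀ w → w div2^ k / 2 ≡ w div2^ suc k
  half w = trans (m/n/o≡m/[n*o] w (2 ^ k) 2 {{m^n≢0 2 k}} {{_}} {{nz}})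
    (/-congʳ {m = w} {{nz}} {{m^n≢0 2 (suc k)}} (*-comm (2 ^ k) 2))
  -- Thus `a` and `b` can differ only in their last binary digit, which is the leading bit of
  -- `bits (suc k)`.
  a/2≡b/2 : a / 2 ≡ b / 2
  a/2≡b/2 = trans (half u) (trans eq (sym (half v)))
  a≡b : a % 2 ≡ b % 2 → a ≡ b
  a≡b e = trans (m≡m%n+[m/n]*n a 2)
    (trans (cong₂ (λ r q → r + q * 2) e a/2≡b/2) (sym (m≡m%n+[m/n]*n b 2)))
  a%2≤b%2 : a % 2 ≤ b % 2
  a%2≤b%2 = +-cancelʳ-≤ (b / 2 * 2) (a % 2) (b % 2) (begin
    a % 2 + b / 2 * 2 ≡⟨ cong (λ q → a % 2 + q * 2) a/2≡b/2 ⟨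
    a % 2 + a / 2 * 2 ≡⟨ m≡m%n+[m/n]*n a 2 ⟨
    a                 ≤⟨ /-monoˡ-≤ (2 ^ k) {{m^n≢0 2 k}} u≤v ⟩
    b                 ≡⟨ m≡m%n+[m/n]*n b 2 ⟩
    b % 2 + b / 2 * 2 ∎)
    where open ≤-Reasoning
  length-bits : ∀ k w → length (bits k w) ≡ k
  length-bits zero    w = refl
  length-bits (suc k) w = cong suc (length-bits k w)
  step : ∀ r s → a % 2 ≡ r → b % 2 ≡ s → r < 2 → s < 2 →
         ((r ≡ᵇ 1) ∷ bits k u) ≤ₗ ((s ≡ᵇ 1) ∷ bits k v)
  step 0 0 p q _ _ = false ∷ bits-mono k (a≡b (trans p (sym q))) u≤v
  step 0 1 p q _ _ =
    false<true (trans (length-bits k u) (sym (length-bits k v)))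
  step 1 0 p q _ _ = contradiction (subst₂ _≤_ p q a%2≤b%2) λ ()
  step 1 1 p q _ _ = true ∷ bits-mono k (a≡b (trans p (sym q))) u≤v
  step (suc (suc _)) _ _ _ (s≤s (s≤s ())) _
  step _ (suc (suc _)) _ _ _ (s≤s (s≤s ()))

-- Runs and exponents under the lexicographic order

run : Bool → List Bool → ℕ
run b xs = length (takeWhile (b ≟ᵇ_) xs)

afterRun : Bool → List Bool → List Bool
afterRun b xs = drop 1 (dropWhile (b ≟ᵇ_) xs)

-- If the first difference lies within the run, the smaller string has the `false` that ends its run
-- while the larger one continues. Otherwise the runs agree and the first difference survives in
-- what follows them.
run-true-mono : ∀ {xs ys} → xs ≤ₗ ys →
  run true xs < run true ys ⊎ (run true xs ≡ run true ys × afterRun true xs ≤ₗ afterRun true ys)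
run-true-mono []             = inj₂ (refl , [])
run-true-mono (false ∷ le)   = inj₂ (refl , le)
run-true-mono (true ∷ le)    = Sum.map s≤s (Product.map₁ (cong suc)) (run-true-mono le)
run-true-mono (false<true _) = inj₁ (s≤s z≤n)

-- Now the larger string ends its run first; the reversal fits the regime `-k` of a run of zeros.
run-false-antimono : ∀ {xs ys} → xs ≤ₗ ys →
  run false ys < run false xs ⊎ (run false xs ≡ run false ys × afterRun false xs ≤ₗ afterRun false ys)
run-false-antimono []             = inj₂ (refl , [])
run-false-antimono (true ∷ le)    = inj₂ (refl , le)
run-false-antimono (false ∷ le)   = Sum.map s≤s (Product.map₁ (cong suc)) (run-false-antimono le)
run-false-antimono (false<true _) = inj₁ (s≤s z≤n)

exponent<4 : ∀ xs → exponent xs < 4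
exponent<4 []           = s≤s z≤n
exponent<4 (b ∷ [])     = s≤s (≤-trans (*-monoʳ-≤ 2 (bitℕ≤1 b)) (n≤1+n 2))
exponent<4 (b ∷ c ∷ _)  = s≤s (+-mono-≤ (*-monoʳ-≤ 2 (bitℕ≤1 b)) (bitℕ≤1 c))

-- Equal lengths ensure that missing bits, read as zero, are missing on both sides.
exponent-mono : ∀ {xs ys} → xs ≤ₗ ys →
  exponent xs < exponent ys ⊎ (exponent xs ≡ exponent ys × drop 2 xs ≤ₗ drop 2 ys)
exponent-mono []                     = inj₂ (refl , [])
exponent-mono (b ∷ [])               = inj₂ (refl , [])
exponent-mono (b ∷ c ∷ le)           = inj₂ (refl , le)
exponent-mono (b ∷ false<true _)     = inj₁ (+-monoʳ-< (2 * bitℕ b) (s≤s z≤n))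
exponent-mono {_ ∷ []} {_ ∷ []} (false<true _) = inj₁ (s≤s z≤n)
-- The leading exponent bit weighs 2, the other at most 1.
exponent-mono {_ ∷ c ∷ _} {_ ∷ d ∷ _} (false<true _) = inj₁ (s≤s (≤-trans (bitℕ≤1 c) (m≤m+n 1 _)))

-- Monotonicity of decoding

shifted : ℤ → List Bool → ℤ
shifted ρ xs = + 4 ℤ.* ρ ℤ.+ + exponent xs

-- The right-hand side of `decode`, abstracted over the regime and the bits after the run, so that
-- `decode` unfolds to it.
fields : ℤ → List Bool → ℚ
fields ρ xs = scaled (shifted ρ xs) (bitsℕ (drop 2 xs)) (length (drop 2 xs))

fields-mono-shifted : ∀ ρ σ xs ys → shifted ρ xs ℤ.< shifted σ ys → fields ρ xs ℚ.≤ fields σ ys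
fields-mono-shifted ρ σ xs ys =
  scaled-mono-< (bitsℕ fx) (bitsℕ fy) (length fx) (length fy) (<⇒≤ (bitsℕ<2^length fx))
  where
  fx = drop 2 xs
  fy = drop 2 ys

-- One unit of regime weighs 4 and every exponent is below 4, so no exponent compensates for a
-- smaller regime.
fields-mono-regime : ∀ ρ σ xs ys → ρ ℤ.< σ → fields ρ xs ℚ.≤ fields σ ys
fields-mono-regime ρ σ xs ys ρ<σ = fields-mono-shifted ρ σ xs ys (begin-strict
  + 4 ℤ.* ρ ℤ.+ + exponent xs  <⟨ ℤₚ.+-monoʳ-< (+ 4 ℤ.* ρ) (ℤ.+<+ (exponent<4 xs)) ⟩
  + 4 ℤ.* ρ ℤ.+ + 4            ≡⟨ ℤₚ.+-comm (+ 4 ℤ.* ρ) (+ 4) ⟩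
  + 4 ℤ.+ + 4 ℤ.* ρ            ≡⟨ ℤₚ.*-suc (+ 4) ρ ⟨
  + 4 ℤ.* ℤ.suc ρ              ≤⟨ ℤₚ.*-monoˡ-≤-nonNeg (+ 4) (ℤₚ.i<j⇒suc[i]≤j ρ<σ) ⟩
  + 4 ℤ.* σ                    ≤⟨ ℤₚ.i≤i+j (+ 4 ℤ.* σ) (+ exponent ys) ⟩
  + 4 ℤ.* σ ℤ.+ + exponent ys  ∎)
  where open ℤₚ.≤-Reasoning

fields-mono-rest : ∀ ρ {xs ys} → xs ≤ₗ ys → fields ρ xs ℚ.≤ fields ρ ys
fields-mono-rest ρ {xs} {ys} le with exponent-mono le
... | inj₁ e<e′ = fields-mono-shifted ρ ρ xs ys (ℤₚ.+-monoʳ-< (+ 4 ℤ.* ρ) (ℤ.+<+ e<e′))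
... | inj₂ (e≡e′ , le′) rewrite e≡e′ | ≤ₗ⇒length≡ le′ =
  scaled-mono-≤ (shifted ρ ys) (length (drop 2 ys)) (bitsℕ-mono le′)

decode-mono : ∀ {xs ys} → xs ≤ₗ ys → decode xs ℚ.≤ decode ys
decode-mono [] = ℚₚ.≤-refl
-- The full run is one longer than the run of the tail, so the regime computes to `+ run true xs`,
-- and to `-[1+ run false xs ]` for a leading `false`.
decode-mono {_ ∷ xs} {_ ∷ ys} (true ∷ le) with run-true-mono le
... | inj₁ lt        = fields-mono-regime (+ run true xs) (+ run true ys)
                         (afterRun true xs) (afterRun true ys) (ℤ.+<+ lt)
... | inj₂ (e , le′) = subst (λ k → fields (+ k) (afterRun true xs) ℚ.≤ decode (true ∷ ys))
                         (sym e) (fields-mono-rest (+ run true ys) le′)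
decode-mono {_ ∷ xs} {_ ∷ ys} (false ∷ le) with run-false-antimono le
... | inj₁ lt        = fields-mono-regime -[1+ run false xs ] -[1+ run false ys ]
                         (afterRun false xs) (afterRun false ys) (ℤ.-<- lt)
... | inj₂ (e , le′) = subst (λ k → fields -[1+ k ] (afterRun false xs) ℚ.≤ decode (false ∷ ys))
                         (sym e) (fields-mono-rest -[1+ run false ys ] le′)
decode-mono {_ ∷ xs} {_ ∷ ys} (false<true _) =
  fields-mono-regime -[1+ run false xs ] (+ run true ys) (afterRun false xs) (afterRun true ys) ℤ.-<+

decode-nonNeg : ∀ xs → 0ℚ ℚ.≤ decode xs
decode-nonNeg []       = ℚₚ.≤-refl
decode-nonNeg (b ∷ xs) = ℚₚ.≤-trans (ℚₚ.nonNegative⁻¹ (2^ℤ E) {{2^ℤ-nonNeg E}}) (2^ℤ≤scaled E f m)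
  where
  rest = drop 1 (dropWhile (b ≟ᵇ_) (b ∷ xs))
  E = + 4 ℤ.* regime b (run b (b ∷ xs)) ℤ.+ + exponent rest
  f = bitsℕ (drop 2 rest)
  m = length (drop 2 rest)

D-mono : ∀ n {u v} → u ≤ v → v < 2 ^ (n ∸ 1) → D n u ℚ.≤ D n v
D-mono n {zero}  {zero}  _ _ = ℚₚ.≤-refl
-- Code 0 bypasses `decode`, so only the sign of the other value matters.
D-mono n {zero}  {suc v} _ _ = decode-nonNeg (bits (n ∸ 1) (suc v))
D-mono n {suc u} {suc v} u≤v v< = decode-mono (bits-mono (n ∸ 1)
  -- Both codes lie below `2 ^ (n ∸ 1)`, so both quotients vanish.
  (trans (m<n⇒m/n≡0 {{2^≢0}} (≤-<-trans u≤v v<)) (sym (m<n⇒m/n≡0 {{2^≢0}} v<))) u≤v)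
  where 2^≢0 = m^n≢0 2 (n ∸ 1)

-- Comparing a real with rationals

-- The order on cuts asks for a rational strictly between, which density supplies.
fromℚ-mono-< : ∀ {p q} → p ℚ.< q → fromℚ p <ᵣ fromℚ q
fromℚ-mono-< = ℚₚ.<-dense

fromℚ-irrefl : ∀ q → ¬ (fromℚ q <ᵣ fromℚ q)
fromℚ-irrefl q (_ , q<r , r<q) = ℚₚ.<-asym q<r r<q

<ᵣ-asym : ∀ {x y} → x <ᵣ y → ¬ (y <ᵣ x)
<ᵣ-asym {x} {y} (p , Ux , Ly) (q , Uy , Lx) with ℚₚ.<-cmp p q
... | tri< p<q _ _  = ℝ.disjoint x (Lx , ℝ.U-upper x p<q Ux)
... | tri≈ _ refl _ = ℝ.disjoint x (Lx , Ux)
... | tri> _ _ q<p  = ℝ.disjoint y (Ly , ℝ.U-upper y q<p Uy)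

<ᵣ-fromℚ-≤ : ∀ {y s t} → s ℚ.≤ t → y <ᵣ fromℚ s → y <ᵣ fromℚ t
<ᵣ-fromℚ-≤ s≤t (q , U , q<s) = q , U , ℚₚ.<-≤-trans q<s s≤t

module _ (y : ℝ) where
  open ℝ y

  -ᵣ-<-fromℚ : ∀ {t} → fromℚ (ℚ.- t) <ᵣ y → (-ᵣ y) <ᵣ fromℚ t
  -ᵣ-<-fromℚ {t} (q , -t<q , Lq) =
    ℚ.- q , subst L (sym (neg-involutive q)) Lq ,
    subst (ℚ.- q ℚ.<_) (neg-involutive t) (ℚₚ.neg-antimono-< -t<q)

  fromℚ-<-ᵣ : ∀ {t} → y <ᵣ fromℚ (ℚ.- t) → fromℚ t <ᵣ (-ᵣ y)
  fromℚ-<-ᵣ {t} (q , Uq , q<-t) =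
    ℚ.- q , subst (ℚ._< ℚ.- q) (neg-involutive t) (ℚₚ.neg-antimono-< q<-t) ,
    subst U (sym (neg-involutive q)) Uq

  -ᵣ-<-fromℚ⁻¹ : ∀ {t} → (-ᵣ y) <ᵣ fromℚ t → fromℚ (ℚ.- t) <ᵣ y
  -ᵣ-<-fromℚ⁻¹ (q , L-q , q<t) = ℚ.- q , ℚₚ.neg-antimono-< q<t , L-q

  fromℚ-<-ᵣ⁻¹ : ∀ {t} → fromℚ t <ᵣ (-ᵣ y) → y <ᵣ fromℚ (ℚ.- t)
  fromℚ-<-ᵣ⁻¹ (q , t<q , U-q) = ℚ.- q , U-q , ℚₚ.neg-antimono-< t<q

  -- Shows that the reversed comparator in the negative branch of `search` is a correct comparator
  -- for `-ᵣ y`.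
  cmp-neg : ∀ {t} c → cmp[ y , ℚ.- t ]≡ c → cmp[ -ᵣ y , t ]≡ reverse c
  cmp-neg less    y<-t          = fromℚ-<-ᵣ y<-t
  cmp-neg equal   (y≤-t , -t≤y) = -t≤y ∘ fromℚ-<-ᵣ⁻¹ , y≤-t ∘ -ᵣ-<-fromℚ⁻¹
  cmp-neg greater -t<y          = -ᵣ-<-fromℚ -t<y

cmpℚ-correct : ∀ q t → cmp[ fromℚ q , t ]≡ cmpℚ q t
cmpℚ-correct q t with ℚₚ.<-cmp q t
... | tri< q<t _ _  = fromℚ-mono-< q<t
... | tri≈ _ refl _ = fromℚ-irrefl q , fromℚ-irrefl q
... | tri> _ _ t<q  = fromℚ-mono-< t<q

-- Π is a partial function

GreatestCodeBelow-unique : ∀ {n y c d} → GreatestCodeBelow n y c → GreatestCodeBelow n y d → c ≡ d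
GreatestCodeBelow-unique {c = c} {d} C D =
  ≤-antisym (greatest D c (isCode C) (below C)) (greatest C d (isCode D) (below D))
  where open GreatestCodeBelow

-- Otherwise 2 would divide the difference 1. This keeps the two tie rules apart.
2∤consecutive : ∀ c → 2 ∣ c → ¬ (2 ∣ suc c)
2∤consecutive c 2∣c 2∣1+c with ∣1⇒≡1 (∣m+n∣m⇒∣n (subst (2 ∣_) (+-comm 1 c) 2∣1+c) 2∣c)
... | ()

RoundsFrom-unique : ∀ {n y c u v} → RoundsFrom n y c u → RoundsFrom n y c v → u ≡ v
RoundsFrom-unique (down _) (down _) = refl
RoundsFrom-unique {n} {y} {c} (down y<T) (up T<y) = contradiction T<y (<ᵣ-asym {y} {fromℚ (T n c)} y<T)
RoundsFrom-unique (down _) (tieDown _ _) = refl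
RoundsFrom-unique (down y<T) (tieUp (_ , T≤y) _) = contradiction y<T T≤y
RoundsFrom-unique {n} {y} {c} (up T<y) (down y<T) = contradiction T<y (<ᵣ-asym {y} {fromℚ (T n c)} y<T)
RoundsFrom-unique (up _) (up _) = refl
RoundsFrom-unique (up T<y) (tieDown (y≤T , _) _) = contradiction T<y y≤T
RoundsFrom-unique (up _) (tieUp _ _) = refl
RoundsFrom-unique (tieDown _ _) (down _) = refl
RoundsFrom-unique (tieDown (y≤T , _) _) (up T<y) = contradiction T<y y≤T
RoundsFrom-unique (tieDown _ _) (tieDown _ _) = refl
RoundsFrom-unique {c = c} (tieDown _ even) (tieUp _ odd) = contradiction odd (2∤consecutive c even)
RoundsFrom-unique (tieUp (_ , T≤y) _) (down y<T) = contradiction y<T T≤y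
RoundsFrom-unique (tieUp _ _) (up _) = refl
RoundsFrom-unique {c = c} (tieUp _ odd) (tieDown _ even) = contradiction odd (2∤consecutive c even)
RoundsFrom-unique (tieUp _ _) (tieUp _ _) = refl

Π⁺-unique : ∀ {n y u v} → Π⁺ n y u → Π⁺ n y v → u ≡ v
Π⁺-unique (small _) (small _) = refl
Π⁺-unique (small y≤) (large <y _) = contradiction <y y≤
Π⁺-unique (small y≤) (middle <y _ _ _) = contradiction <y y≤
Π⁺-unique (large <y _) (small y≤) = contradiction <y y≤
Π⁺-unique (large _ _) (large _ _) = refl
Π⁺-unique (large _ ≤y) (middle _ y< _ _) = contradiction y< ≤y
Π⁺-unique (middle <y _ _ _) (small y≤) = contradiction <y y≤
Π⁺-unique (middle _ y< _ _) (large _ ≤y) = contradiction y< ≤y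
Π⁺-unique {n} {y} (middle _ _ c-max c-rounds) (middle _ _ d-max d-rounds)
  with GreatestCodeBelow-unique {n} {y} c-max d-max
... | refl = RoundsFrom-unique c-rounds d-rounds

-- `Π` is only a relation; uniqueness turns correctness of the search into the forward half of the
-- final equivalence.
Π-unique : ∀ {n y v w} → Π n y v → Π n y w → v ≡ w
Π-unique (isZero _ v≡0) (isZero _ w≡0) = toℕ-injective (trans v≡0 (sym w≡0))
Π-unique (isZero (y≤0 , _) _) (isPos 0<y _) = contradiction 0<y y≤0
Π-unique (isZero (_ , 0≤y) _) (isNeg y<0 _ _ _) = contradiction y<0 0≤y
Π-unique (isPos 0<y _) (isZero (y≤0 , _) _) = contradiction 0<y y≤0
Π-unique (isPos _ v⁺) (isPos _ w⁺) = toℕ-injective (Π⁺-unique v⁺ w⁺)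
Π-unique {y = y} (isPos 0<y _) (isNeg y<0 _ _ _) = contradiction y<0 (<ᵣ-asym {fromℚ 0ℚ} {y} 0<y)
Π-unique (isNeg y<0 _ _ _) (isZero (_ , 0≤y) _) = contradiction y<0 0≤y
Π-unique {y = y} (isNeg y<0 _ _ _) (isPos 0<y _) = contradiction y<0 (<ᵣ-asym {fromℚ 0ℚ} {y} 0<y)
Π-unique {n} (isNeg _ v′ v⁺ v≡) (isNeg _ w′ w⁺ w≡) =
  trans v≡ (trans (cong (negWord n) (toℕ-injective (Π⁺-unique v⁺ w⁺))) (sym w≡))

-- The search satisfies the specification

2^[n∸1]<2^n : ∀ {n} → 1 ≤ n → 2 ^ (n ∸ 1) < 2 ^ n
2^[n∸1]<2^n {suc n} _ = ^-monoʳ-< 2 ≤-refl (n<1+n n)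

-- Makes the reduction modulo `2 ^ n` in `word` harmless. Rounding up from a code gives at most
-- `2 ^ (n ∸ 1)`, still below `2 ^ n`.
Π⁺⇒<2^n : ∀ {n y u} → 2 ≤ n → Π⁺ n y u → u < 2 ^ n
Π⁺⇒<2^n 2≤n (small _) = ≤-trans (s≤s (s≤s z≤n)) (^-monoʳ-≤ 2 2≤n)
Π⁺⇒<2^n {n} 2≤n (large _ _) = ≤-<-trans (m∸n≤m (2 ^ (n ∸ 1)) 1) (2^[n∸1]<2^n (<⇒≤ 2≤n))
Π⁺⇒<2^n {n} {y} {u} 2≤n (middle {c} _ _ c-max rounds) = ≤-<-trans (u≤ rounds) (2^[n∸1]<2^n (<⇒≤ 2≤n))
  where
  open GreatestCodeBelow c-max
  u≤ : ∀ {v} → RoundsFrom n y c v → v ≤ 2 ^ (n ∸ 1)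
  u≤ (down _)      = <⇒≤ isCode
  u≤ (up _)        = isCode
  u≤ (tieDown _ _) = <⇒≤ isCode
  u≤ (tieUp _ _)   = isCode

toℕ-word : ∀ n {u} → u < 2 ^ n → toℕ (word n u) ≡ u
toℕ-word n {u} u<2^n = trans (toℕ-fromℕ< (m%n<n u (2 ^ n) {{nz}})) (m<n⇒m%n≡m {{nz}} u<2^n)
  where nz = m^n≢0 2 n

-- Midpoint bounds for bisection

module _ (ℓ h : ℕ) where
  open ≤-Reasoning

  -- Keeps the interval nonempty when `h` moves down to the midpoint; the gap of two comes from the
  -- guard `1 <ᵇ h ∸ ℓ`.
  ℓ<midpoint : 2 + ℓ ≤ h → ℓ < (ℓ + h) / 2
  ℓ<midpoint gap = begin
    suc ℓ              ≡⟨ m*n/n≡m (suc ℓ) 2 ⟨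
    suc ℓ * 2 / 2      ≡⟨ cong (_/ 2) {suc ℓ * 2} {ℓ + (2 + ℓ)} (solve (ℓ ∷ [])) ⟩
    (ℓ + (2 + ℓ)) / 2  ≤⟨ /-monoˡ-≤ 2 (+-monoʳ-≤ ℓ gap) ⟩
    (ℓ + h) / 2        ∎

  midpoint<h : ℓ < h → (ℓ + h) / 2 < h
  midpoint<h ℓ<h = m<n*o⇒m/o<n (begin-strict
    ℓ + h <⟨ +-monoˡ-< h ℓ<h ⟩
    h + h ≡⟨ solve (h ∷ []) ⟩
    h * 2 ∎)

  module _ (p : ℕ) (h≤ : h ≤ ℓ + 2 * p) where

    midpoint≤ℓ+p : (ℓ + h) / 2 ≤ ℓ + p
    midpoint≤ℓ+p = begin
      (ℓ + h) / 2           ≤⟨ /-monoˡ-≤ 2 (+-monoʳ-≤ ℓ h≤) ⟩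
      (ℓ + (ℓ + 2 * p)) / 2 ≡⟨ cong (_/ 2) {ℓ + (ℓ + 2 * p)} {(ℓ + p) * 2} (solve (ℓ ∷ p ∷ [])) ⟩
      (ℓ + p) * 2 / 2       ≡⟨ m*n/n≡m (ℓ + p) 2 ⟩
      ℓ + p                 ∎

    -- The floor costs nothing here: `p * 2` splits exactly out of the quotient, so a width of at
    -- most `2 * p` is halved on this side too.
    h≤midpoint+p : h ≤ (ℓ + h) / 2 + p
    h≤midpoint+p = begin
      h                       ≡⟨ m*n/n≡m h 2 ⟨
      h * 2 / 2               ≡⟨ cong (_/ 2) {h * 2} {h + h} (solve (h ∷ [])) ⟩
      (h + h) / 2             ≤⟨ /-monoˡ-≤ 2 (+-monoˡ-≤ h h≤) ⟩
      (ℓ + 2 * p + h) / 2     ≡⟨ cong (_/ 2) {ℓ + 2 * p + h} {ℓ + h + p * 2} (solve (ℓ ∷ p ∷ h ∷ [])) ⟩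
      (ℓ + h + p * 2) / 2     ≡⟨ +-distrib-/-∣ʳ (ℓ + h) (n∣m*n p) ⟩
      (ℓ + h) / 2 + p * 2 / 2 ≡⟨ cong (λ k → (ℓ + h) / 2 + k) (m*n/n≡m p 2) ⟩
      (ℓ + h) / 2 + p         ∎

module _ (n : ℕ) (y : ℝ) (C : ℚ → Cmp) (C-correct : ∀ t → cmp[ y , t ]≡ C t) where

  private N = 2 ^ (n ∸ 1)

  -- The upper end h = N is not a code, so y < D n h can only be stated through
  -- the codes from h onwards.
  bisect-correct : ∀ s ℓ h → ℓ < h → h ≤ N → h ≤ ℓ + 2 ^ s → fromℚ (D n ℓ) ≤ᵣ y →
    (∀ c → h ≤ c → c < N → y <ᵣ fromℚ (D n c)) →
    GreatestCodeBelow n y (bisect n C s ℓ h)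
  -- The width bound is now `2 ^ 0`, so every code above `ℓ` is at least `h`.
  bisect-correct zero ℓ h ℓ<h h≤N h≤ℓ+1 Dℓ≤y y<D = record
    { isCode   = <-≤-trans ℓ<h h≤N
    ; below    = Dℓ≤y
    ; greatest = λ c c<N Dc≤y → ≮⇒≥ λ ℓ<c →
        Dc≤y (y<D c (≤-trans h≤ℓ+1 (≤-trans (≤-reflexive (+-comm ℓ 1)) ℓ<c)) c<N)
    }
  bisect-correct (suc s) ℓ h ℓ<h h≤N h≤ Dℓ≤y y<D with 1 <ᵇ h ∸ ℓ in wide
  -- An idle step: the width is at most 1, hence within `2 ^ s`.
  ... | false = bisect-correct s ℓ h ℓ<h h≤N
        (≤-trans (m≤n+m∸n h ℓ) (+-monoʳ-≤ ℓ
          (≤-trans (≮⇒≥ λ 1<h∸ℓ → subst Bool.T wide (<⇒<ᵇ 1<h∸ℓ)) (m^n>0 2 s))))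
        Dℓ≤y y<D
  ... | true with C (D n ((ℓ + h) / 2)) | C-correct (D n ((ℓ + h) / 2))
  -- Monotonicity of `D n` carries the one comparison at the midpoint to all later codes.
  ...   | less | y<Dm = bisect-correct s ℓ m (ℓ<midpoint ℓ h gap) (≤-trans (<⇒≤ m<h) h≤N)
          (midpoint≤ℓ+p ℓ h (2 ^ s) h≤) Dℓ≤y
          (λ c m≤c c<N → <ᵣ-fromℚ-≤ {y} (D-mono n m≤c c<N) y<Dm)
    where
    m = (ℓ + h) / 2
    m<h = midpoint<h ℓ h ℓ<h
    gap : 2 + ℓ ≤ h
    gap = m≤o∸n⇒m+n≤o 2 (<⇒≤ ℓ<h) (<ᵇ⇒< 1 (h ∸ ℓ) (subst Bool.T (sym wide) _))
  ...   | equal | _ , Dm≤y = bisect-correct s ((ℓ + h) / 2) h (midpoint<h ℓ h ℓ<h) h≤N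
          (h≤midpoint+p ℓ h (2 ^ s) h≤) Dm≤y y<D
  ...   | greater | Dm<y = bisect-correct s ((ℓ + h) / 2) h (midpoint<h ℓ h ℓ<h) h≤N
          (h≤midpoint+p ℓ h (2 ^ s) h≤) (<ᵣ-asym {fromℚ (D n ((ℓ + h) / 2))} {y} Dm<y) y<D

  roundAt-correct : ∀ c r → cmp[ y , T n c ]≡ r → RoundsFrom n y c (roundAt c r)
  roundAt-correct c less    y<T = down y<T
  roundAt-correct c greater T<y = up T<y
  roundAt-correct c equal   y≈T with c % 2 in parity | m%n<n c 2
  ... | 0           | _ = tieDown y≈T (m%n≡0⇒n∣m c 2 parity)
  ... | 1           | _ = tieUp y≈T (m%n≡0⇒n∣m (suc c) 2 (trans (%-distribˡ-+ 1 c 2) (cong (λ r → suc r % 2) parity)))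
  ... | suc (suc _) | s≤s (s≤s ())

  magnitudeSearch-correct : 2 ≤ n → fromℚ 0ℚ <ᵣ y → Π⁺ n y (magnitudeSearch n C)
  magnitudeSearch-correct 2≤n 0<y
    with C (minpos n) | C-correct (minpos n) | C (maxpos n) | C-correct (maxpos n)
  ... | less    | y<min     | _       | _           = small (<ᵣ-asym {y} {fromℚ (minpos n)} y<min)
  ... | equal   | y≤min , _ | _       | _           = small y≤min
  ... | greater | min<y     | greater | max<y       = large min<y (<ᵣ-asym {fromℚ (maxpos n)} {y} max<y)
  ... | greater | min<y     | equal   | _ , max≤y   = large min<y max≤y
  ... | greater | min<y     | less    | y<max       = middle min<y y<max
    -- Initially `D n 0` is zero, no code reaches `N`, and `n` steps cover a width of `2 ^ n`, more
    -- than `N`.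
    (bisect-correct n 0 N (m^n>0 2 (n ∸ 1)) ≤-refl (<⇒≤ (2^[n∸1]<2^n (<⇒≤ 2≤n)))
      (<ᵣ-asym {fromℚ 0ℚ} {y} 0<y) (λ c N≤c c<N → contradiction c<N (≤⇒≯ N≤c)))
    (roundAt-correct _ _ (C-correct _))

search-correct : ∀ n → 2 ≤ n → (y : ℝ) (C : ℚ → Cmp) → (∀ t → cmp[ y , t ]≡ C t) → Π n y (search n C)
search-correct n 2≤n y C C-correct with C 0ℚ | C-correct 0ℚ
... | equal   | y≈0 = isZero y≈0 (toℕ-word n (m^n>0 2 n))
... | greater | 0<y = isPos 0<y (subst (Π⁺ n y) (sym (toℕ-word n (Π⁺⇒<2^n 2≤n w⁺))) w⁺)
  where w⁺ = magnitudeSearch-correct n y C C-correct 2≤n 0<y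
... | less    | y<0 = isNeg y<0 _ (subst (Π⁺ n (-ᵣ y)) (sym (toℕ-word n (Π⁺⇒<2^n 2≤n w⁺))) w⁺) refl
  where
  w⁺ = magnitudeSearch-correct n (-ᵣ y) (λ t → reverse (C (ℚ.- t)))
         -- `ℚ.- 0ℚ` computes to `0ℚ`, so `y<0` directly yields positivity of `-ᵣ y`.
         (λ t → cmp-neg y (C (ℚ.- t)) (C-correct (ℚ.- t))) 2≤n (fromℚ-<-ᵣ y {0ℚ} y<0)

theorem6 : (n : ℕ) → 2 ≤ n →
    ((y : ℝ) (C : ℚ → Cmp) → (∀ t → cmp[ y , t ]≡ C t) →
    ∀ w → Π n y w ⇔ (w ≡ search n C))
    × ((q : ℚ) → ∀ w → Π n (fromℚ q) w ⇔ (w ≡ rationalRound n q))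
theorem6 n 2≤n = rounds , λ q → rounds (fromℚ q) (cmpℚ q) (cmpℚ-correct q)
  where
  rounds : (y : ℝ) (C : ℚ → Cmp) → (∀ t → cmp[ y , t ]≡ C t) → ∀ w → Π n y w ⇔ (w ≡ search n C)
  rounds y C C-correct w = mk⇔ (λ Πw → Π-unique Πw Πsearch) (λ { refl → Πsearch })
    where Πsearch = search-correct n 2≤n y C C-correct
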